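{- A recursively enumerable set $A\subseteq\mathbb{N}$ is $D$-w.e.u. if and only if it is $wtt$-complete.
   Context: $\varphi_0,\varphi_1,\ldots$ is a standard enumeration of the unary partial computable functions, $\varphi^{A}_e$ the $e$th unary partial function computable with oracle $A$, $\mathcal{K}=\{e:\varphi_e(e)\downarrow\}$, and $\mathfrak{P}_{\mathrm{fin}}(\mathbb{N})$ the set of finite subsets of $\mathbb{N}$ with its standard computable coding. A recursively enumerable set $A$ is $D$-w.e.u. if there is a computable $f\colon\mathbb{N}\to\mathfrak{P}_{\mathrm{fin}}(\mathbb{N})$ such that for all $e$: if $\varphi_e(z)\downarrow$ for every $z\in f(e)$ then some $z\in f(e)$ has $\varphi_e(z)\neq\mathbb{1}_A(z)$. A recursively enumerable set $A$ is $wtt$-complete if there are an index $e$ and a total computable $f\colon\mathbb{N}\to\mathbb{N}$ such that $\mathbb{1}_{\mathcal{K}}=\varphi^{A}_e$ and for every $x$ the computation of $\varphi^A_e(x)$ queries the oracle only about numbers below $f(x)$. -}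

module Defs where

open import Level using (0ℓ)
open import Data.Nat using (ℕ; zero; suc; _+_; _*_; _<_; _^_)
open import Data.Nat.DivMod using (_/_; _%_)
open import Data.Product using (Σ; ∃; _×_; _,_; proj₁; proj₂)
open import Data.Sum using (_⊎_)
open import Data.Empty using (⊥)
open import Relation.Nullary using (¬_)
open import Relation.Binary.PropositionalEquality using (_≡_; _≢_)
open import Function.Bundles using (_⇔_)

tri : ℕ → ℕ
tri zero    = zero
tri (suc n) = tri n + suc n

pair : ℕ → ℕ → ℕ
pair x y = tri (x + y) + y

unpair : ℕ → ℕ × ℕ
unpair zero = 0 , 0
unpair (suc n) with unpair n
... | zero  , y = suc y , 0
... | suc x , y = x , suc y

-- Programs: unary oracle μ-recursive functions on ℕ (with Cantor pairing)

data Code : Set where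
  czero csucc cid cfst csnd coracle : Code
  cpair ccomp crec : Code → Code → Code
  cmu : Code → Code

-- Gödel numbering of programs (fuel-bounded decoding; components of a
-- code number n are < n, so fuel n never runs out).
decode′ : ℕ → ℕ → Code
decode′ zero    n = czero
decode′ (suc k) n = go (n % 10)
  where
  q = n / 10
  a = proj₁ (unpair q)
  b = proj₂ (unpair q)
  go : ℕ → Code
  go 0 = czero
  go 1 = csucc
  go 2 = cid
  go 3 = cfst
  go 4 = csnd
  go 5 = coracle
  go 6 = cpair (decode′ k a) (decode′ k b)
  go 7 = ccomp (decode′ k a) (decode′ k b)
  go 8 = crec  (decode′ k a) (decode′ k b)
  go 9 = cmu   (decode′ k q)
  go _ = czero

decode : ℕ → Code
decode n = decode′ n n

-- Big-step semantics relative to an oracle A, where an oracle query n is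
-- only permitted when  Ok n  holds (used to express the use bound).
-- Eval A Ok c x y : program c on input x halts with output y, querying
-- the oracle only at numbers satisfying Ok.

mutual
  data Eval (A : ℕ → Set) (Ok : ℕ → Set) : Code → ℕ → ℕ → Set where
    e-zero : ∀ {x} → Eval A Ok czero x 0
    e-succ : ∀ {x} → Eval A Ok csucc x (suc x)
    e-id   : ∀ {x} → Eval A Ok cid x x
    e-fst  : ∀ {x} → Eval A Ok cfst x (proj₁ (unpair x))
    e-snd  : ∀ {x} → Eval A Ok csnd x (proj₂ (unpair x))
    e-orc1 : ∀ {x} → Ok x → A x → Eval A Ok coracle x 1
    e-orc0 : ∀ {x} → Ok x → ¬ A x → Eval A Ok coracle x 0
    e-pair : ∀ {f g x u v} → Eval A Ok f x u → Eval A Ok g x v →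
             Eval A Ok (cpair f g) x (pair u v)
    e-comp : ∀ {f g x u v} → Eval A Ok g x u → Eval A Ok f u v →
             Eval A Ok (ccomp f g) x v
    e-rec0 : ∀ {f g x y} → Eval A Ok f x y →
             Eval A Ok (crec f g) (pair x 0) y
    e-recS : ∀ {f g x n r y} → Eval A Ok (crec f g) (pair x n) r →
             Eval A Ok g (pair x (pair n r)) y →
             Eval A Ok (crec f g) (pair x (suc n)) y
    e-mu   : ∀ {f x n} → MuFrom A Ok f x 0 n → Eval A Ok (cmu f) x n

  data MuFrom (A : ℕ → Set) (Ok : ℕ → Set) (f : Code) (x : ℕ) : ℕ → ℕ → Set where
    mu-here : ∀ {i} → Eval A Ok f (pair x i) 0 → MuFrom A Ok f x i i
    mu-next : ∀ {i k n} → Eval A Ok f (pair x i) (suc k) →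
              MuFrom A Ok f x (suc i) n → MuFrom A Ok f x i n

Empty : ℕ → Set
Empty _ = ⊥

φ : ℕ → ℕ → ℕ → Set
φ e x y = Eval Empty Empty (decode e) x y

φ^ : (A : ℕ → Set) → (Ok : ℕ → Set) → ℕ → ℕ → ℕ → Set
φ^ A Ok e x y = Eval A Ok (decode e) x y

Halts : ℕ → ℕ → Set
Halts e x = ∃ λ y → φ e x y

𝒦 : ℕ → Set
𝒦 e = Halts e e

RE : (ℕ → Set) → Set
RE A = ∃ λ e → ∀ x → A x ⇔ Halts e x

ComputableTotal : (ℕ → ℕ) → Set
ComputableTotal f = ∃ λ i → ∀ x → φ i x (f x)

-- canonical coding of finite sets: z ∈ D_n iff bit z of n is 1
-- ⌊n / 2^z⌋
shiftR : ℕ → ℕ → ℕ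
shiftR zero    n = n
shiftR (suc z) n = shiftR z (n / 2)

_∈D_ : ℕ → ℕ → Set
z ∈D n = shiftR z n % 2 ≡ 1

Neq𝟙 : (ℕ → Set) → ℕ → ℕ → Set
Neq𝟙 A z y = (A z × y ≢ 1) ⊎ (¬ A z × y ≢ 0)

DWEU : (ℕ → Set) → Set
DWEU A = Σ (ℕ → ℕ) λ f → ComputableTotal f ×
  (∀ e → (∀ z → z ∈D f e → Halts e z) →
     ∃ λ z → z ∈D f e × ∃ λ y → φ e z y × Neq𝟙 A z y)

WttComplete : (ℕ → Set) → Set
WttComplete A = ∃ λ e → Σ (ℕ → ℕ) λ f → ComputableTotal f ×
  (∀ x → (𝒦 x → φ^ A (λ n → n < f x) e x 1)
       × (¬ 𝒦 x → φ^ A (λ n → n < f x) e x 0))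

{-# OPTIONS --safe #-}
module Submission where

-- Completeness ⇒ effective undecidability: let a program compute 𝟙_𝒦 from A with queries below h(x).
-- On input x, run it with φ_e answering the queries and halt iff the output is 0. At the index
-- x = p(e) of this very program the output is not 𝟙_𝒦(x), so φ_e errs (or diverges) somewhere
-- below h(p(e)).
--
-- Effective undecidability ⇒ completeness: let g(x) be an index of z ↦ 𝟙_{A_s}(z), where s is the
-- stage at which x enters 𝒦. Using A below the code f(g(x)), which bounds the elements of the set
-- it codes, find a stage t at which A_t is already correct there. If x entered 𝒦 after t, then
-- φ_{g(x)} would be total and correct on f(g(x)); so x ∈ 𝒦 iff x ∈ 𝒦_t. Stages are those of a
-- universal stack machine.

open import Defs
open import Level using (0ℓ)
open import Data.Nat
open import Data.Nat.Properties
open import Data.Nat.DivMod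
open import Data.Nat.Divisibility using (n∣m*n)
open import Data.Product using (∃; _×_; _,_; proj₁; proj₂)
open import Data.Sum using (inj₁; inj₂)
open import Data.Empty using (⊥-elim)
open import Data.Unit using (⊤; tt)
open import Data.List using (List; []; _∷_; replicate)
open import Relation.Nullary using (¬_; yes; no; contradiction)
open import Relation.Binary.PropositionalEquality hiding ([_])
open import Function.Base using (_∘_)
open import Function.Bundles using (_⇔_; mk⇔; Equivalence)
open import Axiom.ExcludedMiddle using (ExcludedMiddle)

-- Cantor pairing

-- This equation and the next describe the walk that `unpair` makes: along an antidiagonal, then to
-- the start of the following one.
pair-zeroʳ : ∀ n → pair (suc n) 0 ≡ suc (pair 0 n)
pair-zeroʳ n rewrite +-identityʳ n | +-identityʳ (tri n + suc n) = +-suc (tri n) n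

pair-sucʳ : ∀ x y → pair x (suc y) ≡ suc (pair (suc x) y)
pair-sucʳ x y rewrite +-suc x y = +-suc (tri (x + y) + suc (x + y)) y

pair-unpair : ∀ n → pair (proj₁ (unpair n)) (proj₂ (unpair n)) ≡ n
pair-unpair zero = refl
pair-unpair (suc n) with unpair n | pair-unpair n
... | zero  , y | eq = trans (pair-zeroʳ y) (cong suc eq)
... | suc x , y | eq = trans (pair-sucʳ x y) (cong suc eq)

-- The induction is on the code `n`, since `unpair` recurses on it; each successor undoes one step
-- of the walk.
unpair-unique : ∀ n x y → pair x y ≡ n → unpair n ≡ (x , y)
unpair-unique zero zero zero eq = refl
unpair-unique zero zero (suc y) eq = contradiction (trans (sym (pair-sucʳ 0 y)) eq) λ ()
unpair-unique zero (suc x) zero eq = contradiction (trans (sym (pair-zeroʳ x)) eq) λ ()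
unpair-unique zero (suc x) (suc y) eq = contradiction (trans (sym (pair-sucʳ (suc x) y)) eq) λ ()
unpair-unique (suc n) zero zero ()
unpair-unique (suc n) (suc x) zero eq
  rewrite unpair-unique n 0 x (suc-injective (trans (sym (pair-zeroʳ x)) eq)) = refl
unpair-unique (suc n) x (suc y) eq
  rewrite unpair-unique n (suc x) y (suc-injective (trans (sym (pair-sucʳ x y)) eq)) = refl

unpair-pair : ∀ x y → unpair (pair x y) ≡ (x , y)
unpair-pair x y = unpair-unique (pair x y) x y refl

pair-injective : ∀ {x y x′ y′} → pair x y ≡ pair x′ y′ → x ≡ x′ × y ≡ y′
pair-injective {x} {y} {x′} {y′} eq = cong proj₁ p , cong proj₂ p
  where
  p : (x , y) ≡ (x′ , y′)
  p = trans (sym (unpair-pair x y)) (trans (cong unpair eq) (unpair-pair x′ y′))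

proj₂-unpair≤ : ∀ n → proj₂ (unpair n) ≤ n
proj₂-unpair≤ n = subst (proj₂ (unpair n) ≤_) (pair-unpair n) (m≤n+m _ _)

proj₁-unpair≤ : ∀ n → proj₁ (unpair n) ≤ n
proj₁-unpair≤ n = subst (proj₁ (unpair n) ≤_) (pair-unpair n)
  (≤-trans (m≤m+n _ _) (≤-trans (n≤tri _) (m≤m+n _ (proj₂ (unpair n)))))
  where
  n≤tri : ∀ m → m ≤ tri m
  n≤tri zero    = z≤n
  n≤tri (suc m) = m≤n+m (suc m) (tri m)

-- Gödel numbers

left right : ℕ → ℕ
left  e = proj₁ (unpair (e / 10))
right e = proj₂ (unpair (e / 10))

node : ℕ → Code → Code → Code → Code
node 0 a b c = czero
node 1 a b c = csucc
node 2 a b c = cid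
node 3 a b c = cfst
node 4 a b c = csnd
node 5 a b c = coracle
node 6 a b c = cpair a b
node 7 a b c = ccomp a b
node 8 a b c = crec a b
node 9 a b c = cmu c
node _ a b c = czero

/-≤-pred : ∀ d {n k} .{{_ : NonTrivial d}} → n ≤ suc k → _/_ n d {{nonTrivial⇒nonZero d}} ≤ k
/-≤-pred d {zero}  _ = subst (_≤ _) (sym (0/n≡0 d {{nonTrivial⇒nonZero d}})) z≤n
/-≤-pred d {suc n} p = s≤s⁻¹ (≤-trans (m/n<m (suc n) d {{_}} {{nonTrivial⇒nonZero d}} (nonTrivial⇒n>1 d)) p)

left≤ : ∀ {e k} → e ≤ suc k → left e ≤ k
left≤ p = ≤-trans (proj₁-unpair≤ _) (/-≤-pred 10 p)

right≤ : ∀ {e k} → e ≤ suc k → right e ≤ k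
right≤ p = ≤-trans (proj₂-unpair≤ _) (/-≤-pred 10 p)

-- The components of a nonzero code are smaller than the code, so two amounts of fuel that both
-- cover `n` also cover the recursive calls.
decode′-fuel : ∀ k l {n} → n ≤ k → n ≤ l → decode′ k n ≡ decode′ l n
decode′-fuel zero    zero    z≤n _ = refl
decode′-fuel zero    (suc l) z≤n _ = refl
decode′-fuel (suc k) zero    _ z≤n = refl
decode′-fuel (suc k) (suc l) {n} p q with n % 10
... | 0 = refl
... | 1 = refl
... | 2 = refl
... | 3 = refl
... | 4 = refl
... | 5 = refl
... | 6 = cong₂ cpair (decode′-fuel k l (left≤ p) (left≤ q))
                      (decode′-fuel k l (right≤ p) (right≤ q))
... | 7 = cong₂ ccomp (decode′-fuel k l (left≤ p) (left≤ q))
                      (decode′-fuel k l (right≤ p) (right≤ q))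
... | 8 = cong₂ crec (decode′-fuel k l (left≤ p) (left≤ q))
                     (decode′-fuel k l (right≤ p) (right≤ q))
... | 9 = cong cmu (decode′-fuel k l (/-≤-pred 10 p) (/-≤-pred 10 q))
... | suc (suc (suc (suc (suc (suc (suc (suc (suc (suc _))))))))) = refl

decode-node : ∀ e → decode e ≡ node (e % 10) (decode (left e)) (decode (right e)) (decode (e / 10))
decode-node zero = refl
decode-node e@(suc m) with e % 10
... | 0 = refl
... | 1 = refl
... | 2 = refl
... | 3 = refl
... | 4 = refl
... | 5 = refl
... | 6 = cong₂ cpair (decode′-fuel m _ (left≤ {e} ≤-refl) ≤-refl)
                      (decode′-fuel m _ (right≤ {e} ≤-refl) ≤-refl)
... | 7 = cong₂ ccomp (decode′-fuel m _ (left≤ {e} ≤-refl) ≤-refl)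
                      (decode′-fuel m _ (right≤ {e} ≤-refl) ≤-refl)
... | 8 = cong₂ crec (decode′-fuel m _ (left≤ {e} ≤-refl) ≤-refl)
                     (decode′-fuel m _ (right≤ {e} ≤-refl) ≤-refl)
... | 9 = cong cmu (decode′-fuel m _ (/-≤-pred 10 {e} ≤-refl) ≤-refl)
... | suc (suc (suc (suc (suc (suc (suc (suc (suc (suc _))))))))) = refl

quotRem-unique : ∀ {n} q r → r < 10 → n ≡ q * 10 + r → n / 10 ≡ q × n % 10 ≡ r
quotRem-unique q r r<10 refl = quot , rem
  where
  quot : (q * 10 + r) / 10 ≡ q
  quot = trans (cong (_/ 10) (+-comm (q * 10) r))
    (trans (+-distrib-/-∣ʳ r {q * 10} {10} (n∣m*n q))
           (cong₂ _+_ (m<n⇒m/n≡0 r<10) (m*n/n≡m q 10)))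
  rem : (q * 10 + r) % 10 ≡ r
  rem = trans (cong (_% 10) (+-comm (q * 10) r)) (trans ([m+kn]%n≡m%n r q 10) (m<n⇒m%n≡m r<10))

decode-*10+ : ∀ q d → d < 10 → decode (q * 10 + d) ≡
  node d (decode (proj₁ (unpair q))) (decode (proj₂ (unpair q))) (decode q)
decode-*10+ q d d<10 = trans (decode-node n)
  (cong₂ (λ d q → node d (decode (proj₁ (unpair q))) (decode (proj₂ (unpair q))) (decode q))
    (proj₂ qr) (proj₁ qr))
  where
  n = q * 10 + d
  qr = quotRem-unique {n} q d d<10 refl

-- Determinism, and substitution of a program for the oracle

module _ {A Ok : ℕ → Set} where

  -- The inputs are kept apart and linked by an equation because indices such as `pair x n` cannot
  -- be unified by matching; they are compared by injectivity of pairing.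
  Eval-deterministic : ∀ {c x x′ y y′} → Eval A Ok c x y → Eval A Ok c x′ y′ → x ≡ x′ → y ≡ y′
  MuFrom-deterministic : ∀ {c x i n n′} → MuFrom A Ok c x i n → MuFrom A Ok c x i n′ → n ≡ n′
  Eval-deterministic e-zero e-zero eq = refl
  Eval-deterministic e-succ e-succ eq = cong suc eq
  Eval-deterministic e-id e-id eq = eq
  Eval-deterministic e-fst e-fst eq = cong (λ x → proj₁ (unpair x)) eq
  Eval-deterministic e-snd e-snd eq = cong (λ x → proj₂ (unpair x)) eq
  Eval-deterministic (e-orc1 _ _) (e-orc1 _ _) eq = refl
  Eval-deterministic (e-orc1 _ a) (e-orc0 _ ¬a) eq = contradiction (subst A eq a) ¬a
  Eval-deterministic (e-orc0 _ ¬a) (e-orc1 _ a) eq = contradiction (subst A (sym eq) a) ¬a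
  Eval-deterministic (e-orc0 _ _) (e-orc0 _ _) eq = refl
  Eval-deterministic (e-pair p q) (e-pair p′ q′) eq =
    cong₂ pair (Eval-deterministic p p′ eq) (Eval-deterministic q q′ eq)
  Eval-deterministic (e-comp p q) (e-comp p′ q′) eq =
    Eval-deterministic q q′ (Eval-deterministic p p′ eq)
  Eval-deterministic (e-rec0 {x = x} p) (e-rec0 {x = x′} p′) eq =
    Eval-deterministic p p′ (proj₁ (pair-injective {x} {0} {x′} {0} eq))
  Eval-deterministic (e-rec0 {x = x} p) (e-recS {x = x′} {n} p′ q′) eq =
    contradiction (proj₂ (pair-injective {x} {0} {x′} {suc n} eq)) λ ()
  Eval-deterministic (e-recS {x = x} {n} p q) (e-rec0 {x = x′} p′) eq =
    contradiction (proj₂ (pair-injective {x} {suc n} {x′} {0} eq)) λ ()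
  Eval-deterministic (e-recS {x = x} {n} p q) (e-recS {x = x′} {n′} p′ q′) eq
    with pair-injective {x} {suc n} {x′} {suc n′} eq
  ... | refl , refl = Eval-deterministic q q′
        (cong (λ r → pair x (pair n r)) (Eval-deterministic p p′ refl))
  Eval-deterministic (e-mu {x = x} m) (e-mu {x = .x} m′) refl = MuFrom-deterministic m m′
  MuFrom-deterministic (mu-here p) (mu-here p′) = refl
  MuFrom-deterministic (mu-here p) (mu-next p′ m′) = contradiction (Eval-deterministic p p′ refl) λ ()
  MuFrom-deterministic (mu-next p m) (mu-here p′) = contradiction (Eval-deterministic p p′ refl) λ ()
  MuFrom-deterministic (mu-next p m) (mu-next p′ m′) = MuFrom-deterministic m m′

  -- A known zero at distance `k` bounds the search, which may stop at an earlier zero.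
  MuFrom-search : ∀ {c x} (p : ℕ → ℕ) → (∀ i → Eval A Ok c (pair x i) (p i)) →
    ∀ k i → p (k + i) ≡ 0 → ∃ λ n → MuFrom A Ok c x i n × p n ≡ 0
  MuFrom-search p ev k i eq with p i in eqᵢ | ev i
  ... | zero  | evᵢ = i , mu-here evᵢ , eqᵢ
  MuFrom-search p ev zero i eq | suc _ | evᵢ = contradiction (trans (sym eqᵢ) eq) λ ()
  MuFrom-search p ev (suc k) i eq | suc _ | evᵢ
    with MuFrom-search p ev k (suc i) (trans (cong p (+-suc k i)) eq)
  ... | n , m , eqₙ = n , mu-next evᵢ m , eqₙ

-- With a program for a set in place of the oracle, this is relative computation; with a constant
-- program, it fixes a parameter.
_[_] : Code → Code → Code
czero     [ d ] = czero
csucc     [ d ] = csucc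
cid       [ d ] = cid
cfst      [ d ] = cfst
csnd      [ d ] = csnd
coracle   [ d ] = d
cpair f g [ d ] = cpair (f [ d ]) (g [ d ])
ccomp f g [ d ] = ccomp (f [ d ]) (g [ d ])
crec f g  [ d ] = crec (f [ d ]) (g [ d ])
cmu f     [ d ] = cmu (f [ d ])

[coracle] : ∀ c → c [ coracle ] ≡ c
[coracle] czero = refl
[coracle] csucc = refl
[coracle] cid = refl
[coracle] cfst = refl
[coracle] csnd = refl
[coracle] coracle = refl
[coracle] (cpair f g) = cong₂ cpair ([coracle] f) ([coracle] g)
[coracle] (ccomp f g) = cong₂ ccomp ([coracle] f) ([coracle] g)
[coracle] (crec f g) = cong₂ crec ([coracle] f) ([coracle] g)
[coracle] (cmu f) = cong cmu ([coracle] f)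

module _ {A Ok B Ok′ : ℕ → Set} {d : Code}
         (d⊨1 : ∀ {x} → Ok x → A x → Eval B Ok′ d x 1)
         (d⊨0 : ∀ {x} → Ok x → ¬ A x → Eval B Ok′ d x 0) where

  -- The program `d` has to answer correctly only on admissible queries, which is how a use bound is
  -- exploited.
  Eval-[] : ∀ {c x y} → Eval A Ok c x y → Eval B Ok′ (c [ d ]) x y
  MuFrom-[] : ∀ {c x i n} → MuFrom A Ok c x i n → MuFrom B Ok′ (c [ d ]) x i n
  Eval-[] e-zero = e-zero
  Eval-[] e-succ = e-succ
  Eval-[] e-id = e-id
  Eval-[] e-fst = e-fst
  Eval-[] e-snd = e-snd
  Eval-[] (e-orc1 o a) = d⊨1 o a
  Eval-[] (e-orc0 o a) = d⊨0 o a
  Eval-[] (e-pair p q) = e-pair (Eval-[] p) (Eval-[] q)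
  Eval-[] (e-comp p q) = e-comp (Eval-[] p) (Eval-[] q)
  Eval-[] (e-rec0 p) = e-rec0 (Eval-[] p)
  Eval-[] (e-recS {x = x} p q) = e-recS {x = x} (Eval-[] p) (Eval-[] q)
  Eval-[] (e-mu m) = e-mu (MuFrom-[] m)
  MuFrom-[] (mu-here p) = mu-here (Eval-[] p)
  MuFrom-[] (mu-next p m) = mu-next (Eval-[] p) (MuFrom-[] m)

-- No query is admissible on the left, so the conditions on the replacement for the oracle are
-- vacuous, and the oracle itself can be that replacement.
Eval-oracle-free : ∀ {A Ok c x y} → Eval Empty Empty c x y → Eval A Ok c x y
Eval-oracle-free {A} {Ok} {c} {x} {y} p =
  subst (λ c → Eval A Ok c x y) ([coracle] c) (Eval-[] (λ ()) (λ ()) p)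

-- Total computable functions, bundled with a program

record Program : Set₁ where
  field
    code : Code
    fun  : ℕ → ℕ
    eval : ∀ {A Ok} x → Eval A Ok code x (fun x)

open Program

-- Keeps the code but states its function without the detours through pairing and unpairing.
_withFun_by_ : (F : Program) (f : ℕ → ℕ) → (∀ x → fun F x ≡ f x) → Program
code (F withFun f by eq) = code F
fun  (F withFun f by eq) = f
eval (F withFun f by eq) x = subst (Eval _ _ (code F) x) (eq x) (eval F x)

ID FST SND SUC : Program
ID  = record { code = cid ; fun = λ x → x ; eval = λ _ → e-id }
FST = record { code = cfst ; fun = λ x → proj₁ (unpair x) ; eval = λ _ → e-fst }
SND = record { code = csnd ; fun = λ x → proj₂ (unpair x) ; eval = λ _ → e-snd }
SUC = record { code = csucc ; fun = suc ; eval = λ _ → e-succ }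

constant : ℕ → Code
constant zero    = czero
constant (suc k) = ccomp csucc (constant k)

Eval-constant : ∀ {A Ok} k {x} → Eval A Ok (constant k) x k
Eval-constant zero    = e-zero
Eval-constant (suc k) = e-comp (Eval-constant k) e-succ

CONST : ℕ → Program
CONST k = record { code = constant k ; fun = λ _ → k ; eval = λ _ → Eval-constant k }

infixr 9 _⊙_
_⊙_ : Program → Program → Program
code (F ⊙ G) = ccomp (code F) (code G)
fun  (F ⊙ G) x = fun F (fun G x)
eval (F ⊙ G) x = e-comp (eval G x) (eval F _)

⟨_,_⟩ : Program → Program → Program
code ⟨ F , G ⟩ = cpair (code F) (code G)
fun  ⟨ F , G ⟩ x = pair (fun F x) (fun G x)
eval ⟨ F , G ⟩ x = e-pair (eval F x) (eval G x)

primrec : (ℕ → ℕ) → (ℕ → ℕ) → ℕ → ℕ → ℕ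
primrec f g x zero    = f x
primrec f g x (suc n) = g (pair x (pair n (primrec f g x n)))

Eval-primrec : ∀ {A Ok} F G x n →
  Eval A Ok (crec (code F) (code G)) (pair x n) (primrec (fun F) (fun G) x n)
Eval-primrec F G x zero    = e-rec0 (eval F x)
Eval-primrec F G x (suc n) = e-recS {x = x} (Eval-primrec F G x n) (eval G _)

REC : Program → Program → Program
code (REC F G) = crec (code F) (code G)
fun  (REC F G) x = primrec (fun F) (fun G) (proj₁ (unpair x)) (proj₂ (unpair x))
eval (REC F G) x = subst (λ w → Eval _ _ (code (REC F G)) w (fun (REC F G) x)) (pair-unpair x)
  (Eval-primrec F G (proj₁ (unpair x)) (proj₂ (unpair x)))

-- `crec` carries a parameter and a counter; the parameter is the dummy 0, and `SND ⊙ SND` picks out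
-- the previous value.
ITER : ∀ (F : Program) (f : ℕ → ℕ) k → (∀ n → f (suc n) ≡ fun F (f n)) → f 0 ≡ k → Program
ITER F f k f-suc f-zero = (REC (CONST k) (F ⊙ SND ⊙ SND) ⊙ ⟨ CONST 0 , ID ⟩) withFun f by λ n →
  trans (cong₂ (λ x y → primrec _ _ x y)
          (cong proj₁ (unpair-pair 0 n)) (cong proj₂ (unpair-pair 0 n))) (iter n)
  where
  iter : ∀ n → primrec (λ _ → k) (fun (F ⊙ SND ⊙ SND)) 0 n ≡ f n
  iter zero = sym f-zero
  iter (suc n) rewrite unpair-pair 0 (pair n (primrec (λ _ → k) (fun (F ⊙ SND ⊙ SND)) 0 n))
    | unpair-pair n (primrec (λ _ → k) (fun (F ⊙ SND ⊙ SND)) 0 n) =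
    trans (cong (fun F) (iter n)) (sym (f-suc n))

-- Case distinction and decimal digits

caseℕ : ℕ → ℕ → ℕ → ℕ
caseℕ zero    a b = a
caseℕ (suc _) a b = b

-- A recursion of length `D x` whose step discards the counter and the previous value.
CASE : Program → Program → Program → Program
CASE D F G = (REC F (G ⊙ FST) ⊙ ⟨ ID , D ⟩) withFun (λ x → caseℕ (fun D x) (fun F x) (fun G x)) by eq
  where
  eq′ : ∀ x n → primrec (fun F) (fun (G ⊙ FST)) x n ≡ caseℕ n (fun F x) (fun G x)
  eq′ x zero = refl
  eq′ x (suc n) = cong (λ p → fun G (proj₁ p)) (unpair-pair x _)
  eq : ∀ x → fun (REC F (G ⊙ FST) ⊙ ⟨ ID , D ⟩) x ≡ caseℕ (fun D x) (fun F x) (fun G x)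
  eq x rewrite unpair-pair x (fun D x) = eq′ x (fun D x)

PRED : Program
PRED = (REC (CONST 0) (FST ⊙ SND) ⊙ ⟨ CONST 0 , ID ⟩) withFun pred by eq
  where
  eq : ∀ x → fun (REC (CONST 0) (FST ⊙ SND) ⊙ ⟨ CONST 0 , ID ⟩) x ≡ pred x
  eq x rewrite unpair-pair 0 x with x
  ... | zero = refl
  ... | suc n rewrite unpair-pair 0 (pair n (primrec (λ _ → 0) (fun (FST ⊙ SND)) 0 n))
    | unpair-pair n (primrec (λ _ → 0) (fun (FST ⊙ SND)) 0 n) = refl

-- The value of `D` is a position in the list; `G` serves all values beyond it.
SELECT : (D : Program) (Fs : List Program) (G : Program) → Program
SELECT D []       G = G
SELECT D (F ∷ Fs) G = CASE D F (SELECT (PRED ⊙ D) Fs G)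

SUC¹⁰ : Program
SUC¹⁰ = SUC ⊙ SUC ⊙ SUC ⊙ SUC ⊙ SUC ⊙ SUC ⊙ SUC ⊙ SUC ⊙ SUC ⊙ SUC

*10+ : ℕ → Program
*10+ d = ITER SUC¹⁰ (λ n → n * 10 + d) d (λ _ → refl) refl

-- A decimal counter holding remainder and quotient: the digits 0 to 8 go up by one, and 9 carries
-- into the quotient.
DIVMOD10-step : Program
DIVMOD10-step = SELECT FST (replicate 9 ⟨ SUC ⊙ FST , SND ⟩) ⟨ CONST 0 , SUC ⊙ SND ⟩

DIVMOD10-suc : ∀ n → pair (suc n % 10) (suc n / 10) ≡ fun DIVMOD10-step (pair (n % 10) (n / 10))
DIVMOD10-suc n = step (n % 10) (n / 10) (m%n<n n 10)
                      (trans (m≡m%n+[m/n]*n n 10) (+-comm (n % 10) _))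
  where
  digits : ∀ r q → r < 10 → suc n ≡ q * 10 + r → pair (suc n % 10) (suc n / 10) ≡ pair r q
  digits r q r<10 eq with quotRem-unique {suc n} q r r<10 eq
  ... | q≡ , r≡ = cong₂ pair r≡ q≡
  suc-digit : ∀ r q → suc r < 10 → n ≡ q * 10 + r → pair (suc n % 10) (suc n / 10) ≡ pair (suc r) q
  suc-digit r q r<9 eq = digits (suc r) q r<9 (trans (cong suc eq) (sym (+-suc (q * 10) r)))
  step : ∀ r q → r < 10 → n ≡ q * 10 + r →
         pair (suc n % 10) (suc n / 10) ≡ fun DIVMOD10-step (pair r q)
  step r q r<10 eq rewrite unpair-pair r q with r
  ... | 0 = suc-digit 0 q (<ᵇ⇒< 1 10 tt) eq
  ... | 1 = suc-digit 1 q (<ᵇ⇒< 2 10 tt) eq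
  ... | 2 = suc-digit 2 q (<ᵇ⇒< 3 10 tt) eq
  ... | 3 = suc-digit 3 q (<ᵇ⇒< 4 10 tt) eq
  ... | 4 = suc-digit 4 q (<ᵇ⇒< 5 10 tt) eq
  ... | 5 = suc-digit 5 q (<ᵇ⇒< 6 10 tt) eq
  ... | 6 = suc-digit 6 q (<ᵇ⇒< 7 10 tt) eq
  ... | 7 = suc-digit 7 q (<ᵇ⇒< 8 10 tt) eq
  ... | 8 = suc-digit 8 q (<ᵇ⇒< 9 10 tt) eq
  ... | 9 = digits 0 (suc q) (s≤s z≤n) (trans (cong suc (trans eq (+-comm (q * 10) 9))) (sym (+-identityʳ _)))
  ... | suc (suc (suc (suc (suc (suc (suc (suc (suc (suc d))))))))) = contradiction r<10 (m+n≮m 10 d)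

DIVMOD10 MOD10 DIV10 : Program
DIVMOD10 = ITER DIVMOD10-step (λ n → pair (n % 10) (n / 10)) 0 DIVMOD10-suc refl
MOD10 = (FST ⊙ DIVMOD10) withFun (_% 10) by λ n → cong proj₁ (unpair-pair (n % 10) (n / 10))
DIV10 = (SND ⊙ DIVMOD10) withFun (_/ 10) by λ n → cong proj₂ (unpair-pair (n % 10) (n / 10))

-- Indices of programs

NODE : ℕ → Program → Program → Program
NODE d F G = *10+ d ⊙ ⟨ F , G ⟩

decode-node-pair : ∀ d a b → d < 10 → decode (pair a b * 10 + d) ≡ node d (decode a) (decode b) (decode (pair a b))
decode-node-pair d a b d<10 = trans (decode-*10+ (pair a b) d d<10)
  (cong (λ p → node d (decode (proj₁ p)) (decode (proj₂ p)) (decode (pair a b))) (unpair-pair a b))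

-- Abstract, because unfolding would make Agda compute the Gödel numbers of concrete programs.
abstract
  SUBST : Code → Program
  SUBST czero       = CONST 0
  SUBST csucc       = CONST 1
  SUBST cid         = CONST 2
  SUBST cfst        = CONST 3
  SUBST csnd        = CONST 4
  SUBST coracle     = ID
  SUBST (cpair f g) = NODE 6 (SUBST f) (SUBST g)
  SUBST (ccomp f g) = NODE 7 (SUBST f) (SUBST g)
  SUBST (crec f g)  = NODE 8 (SUBST f) (SUBST g)
  SUBST (cmu f)     = *10+ 9 ⊙ SUBST f

  -- A form of the s-m-n theorem: tags are last digits, and the given index `e` is put wherever `c`
  -- calls the oracle.
  decode-SUBST : ∀ c e → decode (fun (SUBST c) e) ≡ c [ decode e ]
  decode-SUBST czero e = refl
  decode-SUBST csucc e = refl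
  decode-SUBST cid e = refl
  decode-SUBST cfst e = refl
  decode-SUBST csnd e = refl
  decode-SUBST coracle e = refl
  decode-SUBST (cpair f g) e =
    trans (decode-node-pair 6 (fun (SUBST f) e) (fun (SUBST g) e) (<ᵇ⇒< 6 10 tt))
          (cong₂ cpair (decode-SUBST f e) (decode-SUBST g e))
  decode-SUBST (ccomp f g) e =
    trans (decode-node-pair 7 (fun (SUBST f) e) (fun (SUBST g) e) (<ᵇ⇒< 7 10 tt))
          (cong₂ ccomp (decode-SUBST f e) (decode-SUBST g e))
  decode-SUBST (crec f g) e =
    trans (decode-node-pair 8 (fun (SUBST f) e) (fun (SUBST g) e) (<ᵇ⇒< 8 10 tt))
          (cong₂ crec (decode-SUBST f e) (decode-SUBST g e))
  decode-SUBST (cmu f) e = trans (decode-*10+ (fun (SUBST f) e) 9 ≤-refl) (cong cmu (decode-SUBST f e))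

  -- Since 5 is the index of `coracle`, substituting it leaves `c` unchanged.
  index : ∀ c → ∃ λ e → decode e ≡ c
  index c = fun (SUBST c) 5 , trans (decode-SUBST c 5) ([coracle] c)

-- The tag 7 stands for composition, and 1 is the index of `csucc`.
constantIndex : ℕ → ℕ
constantIndex zero    = 0
constantIndex (suc k) = pair 1 (constantIndex k) * 10 + 7

CONSTANT-INDEX : Program
CONSTANT-INDEX = ITER (NODE 7 (CONST 1) ID) constantIndex 0 (λ _ → refl) refl

decode-constantIndex : ∀ k → decode (constantIndex k) ≡ constant k
decode-constantIndex zero = refl
decode-constantIndex (suc k) =
  trans (decode-node-pair 7 1 (constantIndex k) (<ᵇ⇒< 7 10 tt)) (cong (ccomp csucc) (decode-constantIndex k))

-- A stack machine running all programs

-- The machine branches on digits and evaluation on programs; matching on a view settles both at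
-- once.
data View (e : ℕ) : Code → Set where
  zeroᵛ   : e % 10 ≡ 0 → View e czero
  succᵛ   : e % 10 ≡ 1 → View e csucc
  idᵛ     : e % 10 ≡ 2 → View e cid
  fstᵛ    : e % 10 ≡ 3 → View e cfst
  sndᵛ    : e % 10 ≡ 4 → View e csnd
  oracleᵛ : e % 10 ≡ 5 → View e coracle
  pairᵛ   : e % 10 ≡ 6 → View e (cpair (decode (left e)) (decode (right e)))
  compᵛ   : e % 10 ≡ 7 → View e (ccomp (decode (left e)) (decode (right e)))
  recᵛ    : e % 10 ≡ 8 → View e (crec (decode (left e)) (decode (right e)))
  muᵛ     : e % 10 ≡ 9 → View e (cmu (decode (e / 10)))

view : ∀ e → View e (decode e)
view e = subst (View e) (sym (decode-node e)) (go (e % 10) refl)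
  where
  go : ∀ d → e % 10 ≡ d → View e (node d (decode (left e)) (decode (right e)) (decode (e / 10)))
  go 0 = zeroᵛ
  go 1 = succᵛ
  go 2 = idᵛ
  go 3 = fstᵛ
  go 4 = sndᵛ
  go 5 = oracleᵛ
  go 6 = pairᵛ
  go 7 = compᵛ
  go 8 = recᵛ
  go 9 = muᵛ
  go (suc (suc (suc (suc (suc (suc (suc (suc (suc (suc d)))))))))) eq =
    contradiction (subst (_< 10) eq (m%n<n e 10)) (m+n≮m 10 d)

-- A frame says what to do with the value returned to it.
data Frame : Set where
  apply           : (e : ℕ) → Frame
  pairˡ           : (b x : ℕ) → Frame
  pairʳ           : (u : ℕ) → Frame
  recurse search  : (b x n : ℕ) → Frame

Stack State : Set
Stack = List Frame
State = ℕ × Stack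

applyStep : ℕ → ℕ → ℕ → Stack → State
applyStep 0 e v k = 0 , k
applyStep 1 e v k = suc v , k
applyStep 2 e v k = v , k
applyStep 3 e v k = proj₁ (unpair v) , k
applyStep 4 e v k = proj₂ (unpair v) , k
-- No query is ever answered here, so the machine loops in this state.
applyStep 5 e v k = v , apply e ∷ k
applyStep 6 e v k = v , apply (left e) ∷ pairˡ (right e) v ∷ k
applyStep 7 e v k = v , apply (right e) ∷ apply (left e) ∷ k
applyStep 8 e v k with unpair v
... | x , zero  = x , apply (left e) ∷ k
... | x , suc n = pair x n , apply e ∷ recurse (right e) x n ∷ k
applyStep _ e v k = pair v 0 , apply (e / 10) ∷ search (e / 10) v 0 ∷ k

step : State → State
-- Halted states are fixed points, so halting persists at later stages.
step (v , []) = v , []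
step (v , apply e ∷ k) = applyStep (e % 10) e v k
step (v , pairˡ b x ∷ k) = x , apply b ∷ pairʳ v ∷ k
step (v , pairʳ u ∷ k) = pair u v , k
step (v , recurse b x n ∷ k) = pair x (pair n v) , apply b ∷ k
step (zero , search b x i ∷ k) = i , k
step (suc v , search b x i ∷ k) = pair x (suc i) , apply b ∷ search b x (suc i) ∷ k

-- Halting of the machine and evaluation

data Terminates : State → Set where
  done : ∀ {v} → Terminates (v , [])
  next : ∀ {s} → Terminates (step s) → Terminates s

-- Termination of the remaining stack on the result is passed along as a continuation, which lets
-- the induction follow the evaluation.
Eval⇒Terminates : ∀ e {v y k} → Eval Empty Empty (decode e) v y →
  Terminates (y , k) → Terminates (v , apply e ∷ k)
Eval⇒Terminates e p t = go e (view e) p t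
  where
  go : ∀ e {c v y k} → View e c → Eval Empty Empty c v y →
    Terminates (y , k) → Terminates (v , apply e ∷ k)
  goMu : ∀ e {v i n k} → MuFrom Empty Empty (decode e) v i n →
    Terminates (n , k) → Terminates (pair v i , apply e ∷ search e v i ∷ k)
  by : ∀ e {d v k} → e % 10 ≡ d → Terminates (applyStep d e v k) → Terminates (v , apply e ∷ k)
  by e refl t = next t
  go e (zeroᵛ eq) e-zero t = by e eq t
  go e (succᵛ eq) e-succ t = by e eq t
  go e (idᵛ eq) e-id t = by e eq t
  go e (fstᵛ eq) e-fst t = by e eq t
  go e (sndᵛ eq) e-snd t = by e eq t
  go e (pairᵛ eq) (e-pair p q) t =
    by e eq (go (left e) (view _) p (next (go (right e) (view _) q (next t))))
  go e (compᵛ eq) (e-comp p q) t = by e eq (go (right e) (view _) p (go (left e) (view _) q t))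
  go e {k = k} (recᵛ eq) (e-rec0 {x = x} p) t =
    by e eq (subst Terminates (sym s≡) (go (left e) (view _) p t))
    where
    s≡ : applyStep 8 e (pair x 0) k ≡ (x , apply (left e) ∷ k)
    s≡ rewrite unpair-pair x 0 = refl
  go e {k = k} (recᵛ eq) (e-recS {x = x} {n} p q) t =
    by e eq (subst Terminates (sym s≡) (go e (recᵛ eq) p (next (go (right e) (view _) q t))))
    where
    s≡ : applyStep 8 e (pair x (suc n)) k ≡ (pair x n , apply e ∷ recurse (right e) x n ∷ k)
    s≡ rewrite unpair-pair x (suc n) = refl
  go e (muᵛ eq) (e-mu m) t = by e eq (goMu (e / 10) m t)
  goMu e (mu-here p) t = go e (view e) p (next t)
  goMu e (mu-next p m) t = go e (view e) p (next (goMu e m t))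

-- The invariant for reading runs backwards: every evaluation still owed by the stack, once `v` is
-- returned to it, has a value.
Converges : Stack → ℕ → Set
Converges [] v = ⊤
Converges (apply e ∷ k) v = ∃ λ y → φ e v y × Converges k y
Converges (pairˡ b x ∷ k) v = ∃ λ y → φ b x y × Converges k (pair v y)
Converges (pairʳ u ∷ k) v = Converges k (pair u v)
Converges (recurse b x n ∷ k) v = ∃ λ y → φ b (pair x (pair n v)) y × Converges k y
Converges (search b x i ∷ k) zero = Converges k i
Converges (search b x i ∷ k) (suc v) =
  ∃ λ n → MuFrom Empty Empty (decode b) x (suc i) n × Converges k n

Converges-search : ∀ b x i v {k} → φ b (pair x i) v → Converges (search b x i ∷ k) v →
  ∃ λ n → MuFrom Empty Empty (decode b) x i n × Converges k n
Converges-search b x i zero    p c = i , mu-here p , c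
Converges-search b x i (suc v) p (n , m , c) = n , mu-next p m , c

Converges-step : ∀ v k → Converges (proj₂ (step (v , k))) (proj₁ (step (v , k))) → Converges k v
Converges-step v [] c = tt
Converges-step v (apply e ∷ k) c = go (view e) refl c
  where
  go : ∀ {d} → View e d → decode e ≡ d →
    Converges (proj₂ (applyStep (e % 10) e v k)) (proj₁ (applyStep (e % 10) e v k)) →
    ∃ λ y → Eval Empty Empty d v y × Converges k y
  go (zeroᵛ eq) _ c rewrite eq = _ , e-zero , c
  go (succᵛ eq) _ c rewrite eq = _ , e-succ , c
  go (idᵛ eq) _ c rewrite eq = _ , e-id , c
  go (fstᵛ eq) _ c rewrite eq = _ , e-fst , c
  go (sndᵛ eq) _ c rewrite eq = _ , e-snd , c
  -- The looping state is its own successor, so the hypothesis is already the goal.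
  go (oracleᵛ eq) dec c rewrite eq | dec = c
  go (pairᵛ eq) _ c rewrite eq with c
  ... | _ , p , _ , q , c = _ , e-pair p q , c
  go (compᵛ eq) _ c rewrite eq with c
  ... | _ , p , _ , q , c = _ , e-comp p q , c
  go (recᵛ eq) dec c rewrite eq with unpair v | pair-unpair v
  go (recᵛ eq) dec (_ , p , c) | x , zero | refl = _ , e-rec0 p , c
  -- The inner call runs `e` itself, which `dec` identifies with this recursion.
  go (recᵛ eq) dec (_ , p , _ , q , c) | x , suc n | refl =
    _ , e-recS {x = x} (subst (λ c → Eval Empty Empty c (pair x n) _) dec p) q , c
  go (muᵛ eq) _ c rewrite eq with c
  ... | _ , p , c with Converges-search (e / 10) v 0 _ p c
  ... | n , m , c = n , e-mu m , c
Converges-step v (pairˡ b x ∷ k) c = c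
Converges-step v (pairʳ u ∷ k) c = c
Converges-step v (recurse b x n ∷ k) c = c
Converges-step zero (search b x i ∷ k) c = c
Converges-step (suc v) (search b x i ∷ k) (_ , p , c) = Converges-search b x (suc i) _ p c

-- The machine on coded states

encodeFrame : Frame → ℕ
-- Every frame is a tag with two fields, padded by 0, so that it can be taken apart before its tag
-- is known.
encodeFrame (apply e)       = pair 0 (pair e 0)
encodeFrame (pairˡ b x)     = pair 1 (pair b x)
encodeFrame (pairʳ u)       = pair 2 (pair u 0)
encodeFrame (recurse b x n) = pair 3 (pair b (pair x n))
encodeFrame (search b x i)  = pair 4 (pair b (pair x i))

encodeStack : Stack → ℕ
encodeStack []      = 0
encodeStack (f ∷ k) = suc (pair (encodeFrame f) (encodeStack k))

encode : State → ℕ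
encode (v , k) = pair v (encodeStack k)

PUSH : ℕ → Program → Program → Program → Program
PUSH t P Q K = SUC ⊙ ⟨ ⟨ CONST t , ⟨ P , Q ⟩ ⟩ , K ⟩

-- The coded stack is 0 only when empty, and `PRED` opens a nonempty one; `P` and `Q` are the fields
-- of its top frame. The outer list follows the frame tags and the inner one the digits, with
-- `search` and minimization as the default cases.
STEP : Program
STEP = CASE SND ID (SELECT (FST ⊙ FRAME)
    ( SELECT (MOD10 ⊙ P)
      ( ⟨ CONST 0 , K ⟩
      ∷ ⟨ SUC ⊙ FST , K ⟩
      ∷ ⟨ FST , K ⟩
      ∷ ⟨ FST ⊙ FST , K ⟩
      ∷ ⟨ SND ⊙ FST , K ⟩
      ∷ ⟨ FST , APPLY P K ⟩
      ∷ ⟨ FST , APPLY LEFT (PUSH 1 RIGHT FST K) ⟩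
      ∷ ⟨ FST , APPLY RIGHT (APPLY LEFT K) ⟩
      ∷ CASE (SND ⊙ FST)
          ⟨ FST ⊙ FST , APPLY LEFT K ⟩
          ⟨ V⁻ , APPLY P (PUSH 3 RIGHT V⁻ K) ⟩
      ∷ [])
      ⟨ ⟨ FST , CONST 0 ⟩ , APPLY (DIV10 ⊙ P) (PUSH 4 (DIV10 ⊙ P) ⟨ FST , CONST 0 ⟩ K) ⟩
    ∷ ⟨ Q , APPLY P (PUSH 2 FST (CONST 0) K) ⟩
    ∷ ⟨ ⟨ P , FST ⟩ , K ⟩
    ∷ ⟨ ⟨ FST ⊙ Q , ⟨ SND ⊙ Q , FST ⟩ ⟩ , APPLY P K ⟩
    ∷ [])
    (CASE FST ⟨ SND ⊙ Q , K ⟩ ⟨ Q⁺ , APPLY P (PUSH 4 P Q⁺ K) ⟩))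
  where
  FRAME = FST ⊙ PRED ⊙ SND
  K = SND ⊙ PRED ⊙ SND
  P = FST ⊙ SND ⊙ FRAME
  Q = SND ⊙ SND ⊙ FRAME
  LEFT = FST ⊙ DIV10 ⊙ P
  RIGHT = SND ⊙ DIV10 ⊙ P
  V⁻ = ⟨ FST ⊙ FST , PRED ⊙ SND ⊙ FST ⟩
  Q⁺ = ⟨ FST ⊙ Q , SUC ⊙ SND ⊙ Q ⟩
  APPLY : Program → Program → Program
  APPLY E K = PUSH 0 E (CONST 0) K

-- Once the pairings are cancelled, both sides compute to the same number in each case.
STEP-encode : ∀ s → fun STEP (encode s) ≡ encode (step s)
STEP-encode (v , []) rewrite unpair-pair v 0 = refl
STEP-encode (v , apply e ∷ k)
  rewrite unpair-pair v (encodeStack (apply e ∷ k))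
        | unpair-pair (encodeFrame (apply e)) (encodeStack k)
        | unpair-pair 0 (pair e 0)
        | unpair-pair e 0
  with e % 10
... | 0 = refl
... | 1 = refl
... | 2 = refl
... | 3 = refl
... | 4 = refl
... | 5 = refl
... | 6 = refl
... | 7 = refl
... | 8 with unpair v
...   | x , zero  = refl
...   | x , suc n = refl
STEP-encode (v , apply e ∷ k)
    | suc (suc (suc (suc (suc (suc (suc (suc (suc _)))))))) = refl
STEP-encode (v , pairˡ b x ∷ k)
  rewrite unpair-pair v (encodeStack (pairˡ b x ∷ k))
        | unpair-pair (encodeFrame (pairˡ b x)) (encodeStack k)
        | unpair-pair 1 (pair b x)
        | unpair-pair b x = refl
STEP-encode (v , pairʳ u ∷ k)
  rewrite unpair-pair v (encodeStack (pairʳ u ∷ k))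
        | unpair-pair (encodeFrame (pairʳ u)) (encodeStack k)
        | unpair-pair 2 (pair u 0)
        | unpair-pair u 0 = refl
STEP-encode (v , recurse b x n ∷ k)
  rewrite unpair-pair v (encodeStack (recurse b x n ∷ k))
        | unpair-pair (encodeFrame (recurse b x n)) (encodeStack k)
        | unpair-pair 3 (pair b (pair x n))
        | unpair-pair b (pair x n)
        | unpair-pair x n = refl
STEP-encode (v , search b x i ∷ k)
  rewrite unpair-pair v (encodeStack (search b x i ∷ k))
        | unpair-pair (encodeFrame (search b x i)) (encodeStack k)
        | unpair-pair 4 (pair b (pair x i))
        | unpair-pair b (pair x i)
        | unpair-pair x i
  with v
... | zero  = refl
... | suc v = refl

-- Halting stages

run : State → ℕ → State
run s zero    = s
run s (suc t) = step (run s t)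

run-step : ∀ s t → run (step s) t ≡ run s (suc t)
run-step s zero    = refl
run-step s (suc t) = cong step (run-step s t)

-- The coded stack of program e on input x after t steps: zero exactly when it has halted.
pending : ℕ → ℕ → ℕ → ℕ
pending e x t = encodeStack (proj₂ (run (x , apply e ∷ []) t))

abstract
  PENDING : Program
  PENDING = (SND ⊙ REC ⟨ SND , PUSH 0 FST (CONST 0) (CONST 0) ⟩ (STEP ⊙ SND ⊙ SND)) withFun
    (λ w → pending (proj₁ (unpair (proj₁ (unpair w)))) (proj₂ (unpair (proj₁ (unpair w)))) (proj₂ (unpair w)))
    by λ w → stack (proj₁ (unpair w)) (proj₂ (unpair w))
    where
    start advance : ℕ → ℕ
    start = fun ⟨ SND , PUSH 0 FST (CONST 0) (CONST 0) ⟩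
    advance = fun (STEP ⊙ SND ⊙ SND)
    initial : ℕ → State
    initial w = proj₂ (unpair w) , apply (proj₁ (unpair w)) ∷ []
    primrec-run : ∀ w t → primrec start advance w t ≡ encode (run (initial w) t)
    primrec-run w zero = refl
    primrec-run w (suc t) = trans
      (cong (fun STEP) (trans
        (cong (λ p → proj₂ (unpair (proj₂ p))) (unpair-pair w (pair t (primrec start advance w t))))
        (trans (cong proj₂ (unpair-pair t (primrec start advance w t))) (primrec-run w t))))
      (STEP-encode (run (initial w) t))
    stack : ∀ w t → proj₂ (unpair (primrec start advance w t)) ≡ encodeStack (proj₂ (run (initial w) t))
    stack w t = trans (cong (λ s → proj₂ (unpair s)) (primrec-run w t))
      (cong proj₂ (unpair-pair (proj₁ (run (initial w) t)) (encodeStack (proj₂ (run (initial w) t)))))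

  fun-PENDING : ∀ e x t → fun PENDING (pair (pair e x) t) ≡ pending e x t
  fun-PENDING e x t rewrite unpair-pair (pair e x) t | unpair-pair e x = refl

pending-suc : ∀ e x t → pending e x t ≡ 0 → pending e x (suc t) ≡ 0
pending-suc e x t eq with run (x , apply e ∷ []) t
pending-suc e x t eq | v , [] = refl
pending-suc e x t () | v , _ ∷ _

pending-mono : ∀ {e x t t′} → t ≤ t′ → pending e x t ≡ 0 → pending e x t′ ≡ 0
pending-mono {e} {x} {t} t≤t′ eq = go (≤⇒≤′ t≤t′)
  where
  go : ∀ {t′} → t ≤′ t′ → pending e x t′ ≡ 0
  go ≤′-refl = eq
  go (≤′-step {t′} p) = pending-suc e x t′ (go p)

-- `Converges` is trivial at a halted state; pulled back through `t` steps to the initial state, it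
-- provides a value.
pending⇒Halts : ∀ {e x} t → pending e x t ≡ 0 → Halts e x
pending⇒Halts {e} {x} t eq = halts (unwind (x , apply e ∷ []) t (finished (run (x , apply e ∷ []) t) eq))
  where
  ConvergesAt : State → Set
  ConvergesAt (v , k) = Converges k v
  finished : ∀ s → encodeStack (proj₂ s) ≡ 0 → ConvergesAt s
  finished (v , []) eq = tt
  unwind : ∀ s t → ConvergesAt (run s t) → ConvergesAt s
  unwind s zero c = c
  unwind s@(v , k) (suc t) c = Converges-step v k (unwind (step s) t (subst ConvergesAt (sym (run-step s t)) c))
  halts : Converges (apply e ∷ []) x → Halts e x
  halts (y , p , _) = y , p

Halts⇒pending : ∀ {e x} → Halts e x → ∃ λ t → pending e x t ≡ 0
Halts⇒pending {e} {x} (y , p) = go (Eval⇒Terminates e p done)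
  where
  go : ∀ {s} → Terminates s → ∃ λ t → encodeStack (proj₂ (run s t)) ≡ 0
  go done = 0 , refl
  go (next {s} h) with go h
  ... | t , eq = suc t , trans (cong (encodeStack ∘ proj₂) (sym (run-step s t))) eq

-- Finite sets

shiftR-≤ : ∀ z n → n ≤ z → shiftR z n ≡ 0
shiftR-≤ zero    zero p = refl
shiftR-≤ (suc z) n    p = shiftR-≤ z (n / 2) (/-≤-pred 2 p)

-- Halving `n` at least `n` times leaves 0. Hence the code of a finite set can itself serve as a use
-- bound.
∈D⇒< : ∀ {z n} → z ∈D n → z < n
∈D⇒< {z} {n} z∈ = ≰⇒> λ n≤z →
  contradiction (trans (sym (cong (_% 2) (shiftR-≤ z n n≤z))) z∈) λ ()

-- This is 2^n - 1, the code of the set of all numbers below `n`.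
ones : ℕ → ℕ
ones zero    = 0
ones (suc n) = suc (ones n * 2)

ONES : Program
ONES = ITER (SUC ⊙ ITER (SUC ⊙ SUC) (_* 2) 0 (λ _ → refl) refl) ones 0 (λ _ → refl) refl

<⇒∈D-ones : ∀ {z n} → z < n → z ∈D ones n
<⇒∈D-ones {zero}  {suc n} z<n = [m+kn]%n≡m%n 1 (ones n) 2
<⇒∈D-ones {suc z} {suc n} (s≤s z<n) = trans (cong (λ m → shiftR z m % 2) half) (<⇒∈D-ones z<n)
  where
  half : suc (ones n * 2) / 2 ≡ ones n
  half = trans (+-distrib-/-∣ʳ 1 {ones n * 2} {2} (n∣m*n (ones n))) (m*n/n≡m (ones n) 2)

fromComputableTotal : ∀ {f} → ComputableTotal f → Program
fromComputableTotal {f} (i , p) = record { code = decode i ; fun = f ; eval = λ x → Eval-oracle-free (p x) }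

toComputableTotal : ∀ F → ComputableTotal (fun F)
toComputableTotal F with index (code F)
... | i , eq = i , λ x → subst (λ c → Eval Empty Empty c x (fun F x)) (sym eq) (eval F x)

-- Completeness implies effective undecidability

-- The tested value is `v` at every candidate, so the search can stop only if `v` is 0.
MuFrom-cfst : ∀ {A Ok v i n} → MuFrom A Ok cfst v i n → v ≡ 0
MuFrom-cfst {v = v} {i} (mu-here p) =
  trans (sym (cong proj₁ (unpair-pair v i))) (sym (Eval-deterministic p e-fst refl))
MuFrom-cfst (mu-next p m) = MuFrom-cfst m

WttComplete⇒DWEU : ExcludedMiddle 0ℓ → ∀ A → WttComplete A → DWEU A
WttComplete⇒DWEU em A (e₀ , h , h-computable , decides) =
  fun D , toComputableTotal D , errs
  where
  -- cmu cfst halts exactly on input 0.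
  HALT-IF-ZERO : Code
  HALT-IF-ZERO = ccomp (cmu cfst) (decode e₀)
  D : Program
  D = ONES ⊙ fromComputableTotal h-computable ⊙ SUBST HALT-IF-ZERO
  errs : ∀ e → (∀ z → z ∈D fun D e → Halts e z) →
         ∃ λ z → z ∈D fun D e × ∃ λ y → φ e z y × Neq𝟙 A z y
  errs e total with em {∃ λ z → z ∈D fun D e × ∃ λ y → φ e z y × Neq𝟙 A z y}
  ... | yes err = err
  ... | no ¬err = ⊥-elim (¬𝒦x 𝒦x)
    where
    x = fun (SUBST HALT-IF-ZERO) e
    decode-x : decode x ≡ ccomp (cmu cfst) (decode e₀ [ decode e ])
    decode-x = decode-SUBST HALT-IF-ZERO e
    -- Without an error, φ_e computes 𝟙_A below the use bound and can replace the oracle in the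
    -- computation at `x`.
    agrees¹ : ∀ {z} → z < h x → A z → φ e z 1
    agrees¹ {z} z<u a with total z (<⇒∈D-ones z<u)
    ... | y , p with y ≟ 1
    ... | yes refl = p
    ... | no y≢1 = contradiction (z , <⇒∈D-ones z<u , y , p , inj₁ (a , y≢1)) ¬err
    agrees⁰ : ∀ {z} → z < h x → ¬ A z → φ e z 0
    agrees⁰ {z} z<u ¬a with total z (<⇒∈D-ones z<u)
    ... | y , p with y ≟ 0
    ... | yes refl = p
    ... | no y≢0 = contradiction (z , <⇒∈D-ones z<u , y , p , inj₂ (¬a , y≢0)) ¬err
    ¬𝒦x : ¬ 𝒦 x
    -- If `x` were in 𝒦, the inner computation would return 1, on which `cmu cfst` diverges.
    ¬𝒦x k@(y , p) with subst (λ c → Eval Empty Empty c x y) decode-x p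
    ... | e-comp q (e-mu m) = contradiction
      (trans (Eval-deterministic (Eval-[] agrees¹ agrees⁰ (proj₁ (decides x) k)) q refl) (MuFrom-cfst m)) λ ()
    𝒦x : 𝒦 x
    -- Now the inner computation returns 0, so the program with index `x` does halt on `x`.
    𝒦x = 0 , subst (λ c → Eval Empty Empty c x 0) (sym decode-x)
      (e-comp (Eval-[] agrees¹ agrees⁰ (proj₂ (decides x) ¬𝒦x)) (e-mu (mu-here e-fst)))

-- Effective undecidability implies completeness

module _ (em : ExcludedMiddle 0ℓ) (A : ℕ → Set) (a : ℕ) (A⇔Halts : ∀ z → A z ⇔ Halts a z) where

  open Equivalence

  -- Take the maximum of the halting times of the finitely many elements of `A` below `u`; excluded
  -- middle tells which numbers these are.
  stage : ∀ u → ∃ λ t → ∀ {z} → z < u → A z → pending a z t ≡ 0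
  stage zero = 0 , λ ()
  stage (suc u) with stage u | em {A u}
  ... | t , below | no ¬Au = t , λ { (s≤s z≤u) Az → case≤ z≤u Az }
    where
    case≤ : ∀ {z} → z ≤ u → A z → pending a z t ≡ 0
    case≤ z≤u Az with m≤n⇒m<n∨m≡n z≤u
    ... | inj₁ z<u  = below z<u Az
    ... | inj₂ refl = contradiction Az ¬Au
  ... | t , below | yes Au with Halts⇒pending (to (A⇔Halts u) Au)
  ... | s , eq = t ⊔ s , λ { (s≤s z≤u) Az → case≤ z≤u Az }
    where
    case≤ : ∀ {z} → z ≤ u → A z → pending a z (t ⊔ s) ≡ 0
    case≤ z≤u Az with m≤n⇒m<n∨m≡n z≤u
    ... | inj₁ z<u  = pending-mono (m≤m⊔n t s) (below z<u Az)
    ... | inj₂ refl = pending-mono (m≤n⊔m t s) eq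

  -- Searching with the oracle for a correct stage

  χ : ℕ → ℕ
  χ z with em {A z}
  ... | yes _ = 1
  ... | no  _ = 0

  Eval-coracle : ∀ {Ok z} → Ok z → Eval A Ok coracle z (χ z)
  Eval-coracle {z = z} ok with em {A z}
  ... | yes Az = e-orc1 ok Az
  ... | no ¬Az = e-orc0 ok ¬Az

  update : ℕ → ℕ → ℕ → ℕ → ℕ
  update c t z r = caseℕ c r (caseℕ (pending a z t) r 1)

  UPDATE : Program
  UPDATE = CASE FST R (CASE (PENDING ⊙ ⟨ ⟨ CONST a , FST ⊙ SND ⊙ SND ⟩ , FST ⊙ SND ⟩) R (CONST 1))
    where R = SND ⊙ SND ⊙ SND

  fun-UPDATE : ∀ c t z r → fun UPDATE (pair c (pair t (pair z r))) ≡ update c t z r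
  fun-UPDATE c t z r
    rewrite unpair-pair c (pair t (pair z r)) | unpair-pair t (pair z r) | unpair-pair z r
          | fun-PENDING a z t = refl

  -- A flag and not a count: it is 1 once some element of `A` below the bound is missing at stage
  -- `t`. Numbers outside `A` never appear, so A_t has no other errors.
  mistakes : ℕ → ℕ → ℕ
  mistakes t zero    = 0
  mistakes t (suc u) = update (χ u) t u (mistakes t u)

  MISTAKES : Code
  MISTAKES = crec czero (ccomp (code UPDATE) (cpair (ccomp coracle (code (FST ⊙ SND))) cid))

  -- The oracle is asked at the recursion counter only, which stays below `u`; this yields the use
  -- bound.
  Eval-MISTAKES : ∀ {Ok} t u → (∀ {z} → z < u → Ok z) → Eval A Ok MISTAKES (pair t u) (mistakes t u)
  Eval-MISTAKES t zero    ok = e-rec0 {x = t} e-zero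
  Eval-MISTAKES {Ok} t (suc u) ok = e-recS {x = t} (Eval-MISTAKES t u (λ z<u → ok (m<n⇒m<1+n z<u)))
    (e-comp (e-pair (e-comp (eval (FST ⊙ SND) w) oracle) e-id)
            (subst (Eval A Ok (code UPDATE) (pair (χ u) w)) (fun-UPDATE (χ u) t u (mistakes t u))
                   (eval UPDATE (pair (χ u) w))))
    where
    w = pair t (pair u (mistakes t u))
    oracle : Eval A Ok coracle (fun (FST ⊙ SND) w) (χ u)
    oracle rewrite unpair-pair t (pair u (mistakes t u)) | unpair-pair u (mistakes t u) =
      Eval-coracle (ok ≤-refl)

  no-mistakes : ∀ t u → (∀ {z} → z < u → A z → pending a z t ≡ 0) → mistakes t u ≡ 0
  no-mistakes t zero    right = refl
  no-mistakes t (suc u) right with em {A u}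
  ... | no  _ = no-mistakes t u (λ z<u → right (m<n⇒m<1+n z<u))
  ... | yes Au rewrite right ≤-refl Au = no-mistakes t u (λ z<u → right (m<n⇒m<1+n z<u))

  no-mistakes⁻¹ : ∀ t u → mistakes t u ≡ 0 → ∀ {z} → z < u → A z → pending a z t ≡ 0
  no-mistakes⁻¹ t (suc u) eq (s≤s z≤u) Az with em {A u} | pending a u t in eqᵤ | m≤n⇒m<n∨m≡n z≤u
  ... | no ¬Au | _    | inj₁ z<u  = no-mistakes⁻¹ t u eq z<u Az
  ... | no ¬Au | _    | inj₂ refl = contradiction Az ¬Au
  ... | yes _  | zero | inj₁ z<u  = no-mistakes⁻¹ t u eq z<u Az
  ... | yes _  | zero | inj₂ refl = eqᵤ
  no-mistakes⁻¹ t (suc u) () (s≤s z≤u) Az | yes _ | suc _ | _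

  STAGE : Program → Code
  STAGE U = cmu (ccomp MISTAKES ⟨SND,U⟩)
    where ⟨SND,U⟩ = code ⟨ SND , U ⊙ FST ⟩

  -- `stage` guarantees that the search ends, possibly earlier than at `t₀`; correctness is
  -- therefore read off from the flag at the stage found.
  Eval-STAGE : ∀ U x → ∃ λ t → Eval A (_< fun U x) (STAGE U) x t ×
    (∀ {z} → z < fun U x → A z → pending a z t ≡ 0)
  Eval-STAGE U x with stage (fun U x)
  ... | t₀ , right with MuFrom-search (λ t → mistakes t (fun U x)) ev t₀ 0
      (no-mistakes (t₀ + 0) (fun U x) λ z<u Az → pending-mono (m≤m+n t₀ 0) (right z<u Az))
    where
    input : ∀ i → fun ⟨ SND , U ⊙ FST ⟩ (pair x i) ≡ pair i (fun U x)
    input i rewrite unpair-pair x i = refl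
    ev : ∀ i → Eval A (_< fun U x) (ccomp MISTAKES (code ⟨ SND , U ⊙ FST ⟩)) (pair x i) (mistakes i (fun U x))
    ev i = e-comp (subst (Eval A _ _ _) (input i) (eval ⟨ SND , U ⊙ FST ⟩ (pair x i)))
                  (Eval-MISTAKES i (fun U x) (λ z<u → z<u))
  ... | t , m , eq = t , e-mu m , no-mistakes⁻¹ t (fun U x) eq

  -- The reduction of 𝒦 to A

  DIAGONAL : Program
  DIAGONAL = PENDING ⊙ ⟨ ⟨ FST , FST ⟩ , SND ⟩

  fun-DIAGONAL : ∀ x t → fun DIAGONAL (pair x t) ≡ pending x x t
  fun-DIAGONAL x t rewrite unpair-pair x t = fun-PENDING x x t

  MEMBER : Program
  MEMBER = CASE (PENDING ⊙ ⟨ ⟨ CONST a , FST ⟩ , SND ⟩) (CONST 1) (CONST 0)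

  fun-MEMBER : ∀ z t → fun MEMBER (pair z t) ≡ caseℕ (pending a z t) 1 0
  fun-MEMBER z t rewrite unpair-pair z t = cong (λ n → caseℕ n 1 0) (fun-PENDING a z t)

  -- With x in place of the oracle: z ↦ 𝟙_{A_s}(z), where s is the stage at which x enters 𝒦.
  APPROXIMATION : Code
  APPROXIMATION = ccomp (code MEMBER) (cpair cid (ccomp (cmu (code DIAGONAL)) coracle))

  entering : ∀ x → 𝒦 x → ∃ λ s → MuFrom Empty Empty (code DIAGONAL) x 0 s × pending x x s ≡ 0
  entering x x∈𝒦 with Halts⇒pending x∈𝒦
  ... | t , eq = MuFrom-search (pending x x)
    (λ i → subst (Eval Empty Empty (code DIAGONAL) (pair x i)) (fun-DIAGONAL x i) (eval DIAGONAL (pair x i)))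
    t 0 (trans (cong (pending x x) (+-identityʳ t)) eq)

  Eval-APPROXIMATION : ∀ {x s} → MuFrom Empty Empty (code DIAGONAL) x 0 s → ∀ z →
    Eval Empty Empty (APPROXIMATION [ constant x ]) z (caseℕ (pending a z s) 1 0)
  Eval-APPROXIMATION {x} {s} m z = e-comp
    -- Substitution formally passes through the oracle-free codes as well; `Eval-[]` carries their
    -- evaluations over with vacuous hypotheses.
    (e-pair e-id (e-comp (Eval-constant x) (Eval-[] {d = constant x} (λ ()) (λ ()) {c = cmu (code DIAGONAL)} (e-mu m))))
    (Eval-[] {d = constant x} (λ ()) (λ ()) {c = code MEMBER}
      (subst (Eval Empty Empty (code MEMBER) (pair z s)) (fun-MEMBER z s) (eval MEMBER (pair z s))))

  -- The function g of the reduction. `SUBST` expects an index, so `x` is first turned into an index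
  -- of the constant program.
  APPROXIMATION-INDEX : Program
  APPROXIMATION-INDEX = SUBST APPROXIMATION ⊙ CONSTANT-INDEX

  decode-APPROXIMATION-INDEX : ∀ x → decode (fun APPROXIMATION-INDEX x) ≡ APPROXIMATION [ constant x ]
  decode-APPROXIMATION-INDEX x =
    trans (decode-SUBST APPROXIMATION (constantIndex x)) (cong (APPROXIMATION [_]) (decode-constantIndex x))

  DWEU⇒WttComplete : DWEU A → WttComplete A
  DWEU⇒WttComplete (f , f-computable , errs) =
    proj₁ (index DECIDE) , fun U , toComputableTotal U , λ x → accepts x , rejects x
    where
    U OUTPUT : Program
    -- The code f(g(x)) exceeds every element of its set and serves as the use bound.
    U = fromComputableTotal f-computable ⊙ APPROXIMATION-INDEX
    OUTPUT = CASE DIAGONAL (CONST 1) (CONST 0)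
    DECIDE : Code
    DECIDE = ccomp (code OUTPUT) (cpair cid (STAGE U))
    decides : ∀ x {t b} → Eval A (_< fun U x) (STAGE U) x t → caseℕ (pending x x t) 1 0 ≡ b →
      φ^ A (_< fun U x) (proj₁ (index DECIDE)) x b
    decides x {t} {b} p eq = subst (λ c → Eval A (_< fun U x) c x b) (sym (proj₂ (index DECIDE)))
      (e-comp (e-pair e-id p)
        (subst (Eval A (_< fun U x) (code OUTPUT) (pair x t))
               (trans (cong (λ n → caseℕ n 1 0) (fun-DIAGONAL x t)) eq) (eval OUTPUT (pair x t))))
    no-late-entry : ∀ x t → (∀ {z} → z < fun U x → A z → pending a z t ≡ 0) → 𝒦 x → pending x x t ≡ 0
    no-late-entry x t right x∈𝒦 with entering x x∈𝒦
    ... | s , m , eqₛ with ≤-total s t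
    ... | inj₁ s≤t = pending-mono s≤t eqₛ
    -- For an entry at `s` no earlier than `t`, A_s is already correct on the whole set and the
    -- approximation is total, contradicting the error that `errs` promises.
    ... | inj₂ t≤s = ⊥-elim (refute (errs (fun APPROXIMATION-INDEX x) λ z _ → _ , approx z))
      where
      approx : ∀ z → φ (fun APPROXIMATION-INDEX x) z (caseℕ (pending a z s) 1 0)
      approx z = subst (λ c → Eval Empty Empty c z (caseℕ (pending a z s) 1 0))
        (sym (decode-APPROXIMATION-INDEX x)) (Eval-APPROXIMATION m z)
      refute : ¬ ∃ λ z → z ∈D fun U x × ∃ λ y → φ (fun APPROXIMATION-INDEX x) z y × Neq𝟙 A z y
      refute (z , z∈ , y , p , wrong) with Eval-deterministic p (approx z) refl
      refute (z , z∈ , y , p , inj₁ (Az , y≢1)) | y≡ =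
        y≢1 (trans y≡ (cong (λ n → caseℕ n 1 0) (pending-mono t≤s (right (∈D⇒< z∈) Az))))
      refute (z , z∈ , y , p , inj₂ (¬Az , y≢0)) | y≡ with pending a z s in eq
      ... | zero  = ¬Az (from (A⇔Halts z) (pending⇒Halts s eq))
      ... | suc _ = y≢0 y≡
    accepts : ∀ x → 𝒦 x → φ^ A (_< fun U x) (proj₁ (index DECIDE)) x 1
    accepts x x∈𝒦 with Eval-STAGE U x
    ... | t , p , right = decides x p (cong (λ n → caseℕ n 1 0) (no-late-entry x t right x∈𝒦))
    rejects : ∀ x → ¬ 𝒦 x → φ^ A (_< fun U x) (proj₁ (index DECIDE)) x 0
    rejects x x∉𝒦 with Eval-STAGE U x
    -- Any stage will do: a program that never halts is pending at all of them.
    ... | t , p , _ = decides x p rejected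
      where
      rejected : caseℕ (pending x x t) 1 0 ≡ 0
      rejected with pending x x t in eq
      ... | zero  = contradiction (pending⇒Halts t eq) x∉𝒦
      ... | suc _ = refl

mainTheorem13 : ExcludedMiddle 0ℓ → (A : ℕ → Set) → RE A → (DWEU A ⇔ WttComplete A)
mainTheorem13 em A (a , A⇔Halts) = mk⇔ (DWEU⇒WttComplete em A a A⇔Halts) (WttComplete⇒DWEU em A)
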